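{- For all formulas $A,B$: $A\rhd_{\downarrow{\sf NNIL}({\sf par})}B$ if and only if $A\mathrel{|\!\sim_{{\sf NNIL}({\sf par})}}B$.
   Context: Language: $\wedge,\vee,\to,\bot$ over finite atoms ${\sf atom}={\sf var}\cup{\sf par}$ (disjoint variables and parameters); $\vdash$ is ${\sf IPC}$-derivability. Substitutions commute with connectives, fix $\bot$ and fix every parameter; $\theta$ is $A$-projective if $A\vdash a\leftrightarrow\theta(a)$ for all atoms $a$. ${\sf NNIL}$ is the least class containing atoms, $\bot,\top$, closed under $\wedge,\vee$, and containing $B\to C$ whenever $C\in{\sf NNIL}$ and $B$ is built from atoms, $\bot,\top$ by $\wedge,\vee$ only; ${\sf NNIL}({\sf par})$: those whose atoms are all parameters. $\downarrow{\sf NNIL}({\sf par})$ is the set of formulas $E$ for which there are an $E$-projective $\theta$ and $E'\in{\sf NNIL}({\sf par})$ with $\vdash\theta(E)\leftrightarrow E'$. Preservativity: $A\rhd_\Gamma B$ iff for every $E\in\Gamma$, $\vdash E\to A$ implies $\vdash E\to B$. Admissibility: $A\mathrel{|\!\sim_\Gamma}B$ iff for every substitution $\theta$ and every $C\in\Gamma$, $\vdash\theta(C\to A)$ implies $\vdash\theta(C\to B)$. -}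

module Defs where

open import Data.Nat using (ℕ)
open import Data.Fin using (Fin)
open import Data.Sum using (_⊎_; inj₁; inj₂)
open import Data.Product using (Σ; _×_; _,_)
open import Data.List using (List; []; _∷_)
open import Data.List.Membership.Propositional using (_∈_)
open import Data.Unit using (⊤)
open import Data.Empty using (⊥)

module IPC (nv np : ℕ) where

  data Atom : Set where
    var : Fin nv → Atom
    par : Fin np → Atom

  infixr 6 _∧′_
  infixr 5 _∨′_
  infixr 4 _⇒_ _⇔_

  data Fm : Set where
    at   : Atom → Fm
    ⊥′   : Fm
    _∧′_ : Fm → Fm → Fm
    _∨′_ : Fm → Fm → Fm
    _⇒_  : Fm → Fm → Fm

  ⊤′ : Fm
  ⊤′ = ⊥′ ⇒ ⊥′

  _⇔_ : Fm → Fm → Fm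
  A ⇔ B = (A ⇒ B) ∧′ (B ⇒ A)

  infix 2 _⊢_ ⊢_
  data _⊢_ (Γ : List Fm) : Fm → Set where
    hyp  : ∀ {A} → A ∈ Γ → Γ ⊢ A
    ⊥E   : ∀ {A} → Γ ⊢ ⊥′ → Γ ⊢ A
    ∧I   : ∀ {A B} → Γ ⊢ A → Γ ⊢ B → Γ ⊢ A ∧′ B
    ∧E₁  : ∀ {A B} → Γ ⊢ A ∧′ B → Γ ⊢ A
    ∧E₂  : ∀ {A B} → Γ ⊢ A ∧′ B → Γ ⊢ B
    ∨I₁  : ∀ {A B} → Γ ⊢ A → Γ ⊢ A ∨′ B
    ∨I₂  : ∀ {A B} → Γ ⊢ B → Γ ⊢ A ∨′ B
    ∨E   : ∀ {A B C} → Γ ⊢ A ∨′ B → (A ∷ Γ) ⊢ C → (B ∷ Γ) ⊢ C → Γ ⊢ C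
    ⇒I   : ∀ {A B} → (A ∷ Γ) ⊢ B → Γ ⊢ A ⇒ B
    ⇒E   : ∀ {A B} → Γ ⊢ A ⇒ B → Γ ⊢ A → Γ ⊢ B

  ⊢_ : Fm → Set
  ⊢ A = [] ⊢ A

  Subst : Set
  Subst = Fin nv → Fm

  substAt : Subst → Atom → Fm
  substAt θ (var i) = θ i
  substAt θ (par j) = at (par j)

  sub : Subst → Fm → Fm
  sub θ (at a)   = substAt θ a
  sub θ ⊥′       = ⊥′
  sub θ (A ∧′ B) = sub θ A ∧′ sub θ B
  sub θ (A ∨′ B) = sub θ A ∨′ sub θ B
  sub θ (A ⇒ B)  = sub θ A ⇒ sub θ B

  Projective : Fm → Subst → Set
  Projective A θ = ∀ (a : Atom) → (A ∷ []) ⊢ at a ⇔ substAt θ a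

  data ImpFree : Fm → Set where
    at  : ∀ a → ImpFree (at a)
    bot : ImpFree ⊥′
    top : ImpFree ⊤′
    and : ∀ {A B} → ImpFree A → ImpFree B → ImpFree (A ∧′ B)
    or  : ∀ {A B} → ImpFree A → ImpFree B → ImpFree (A ∨′ B)

  data NNIL : Fm → Set where
    at  : ∀ a → NNIL (at a)
    bot : NNIL ⊥′
    top : NNIL ⊤′
    and : ∀ {A B} → NNIL A → NNIL B → NNIL (A ∧′ B)
    or  : ∀ {A B} → NNIL A → NNIL B → NNIL (A ∨′ B)
    imp : ∀ {B C} → ImpFree B → NNIL C → NNIL (B ⇒ C)

  IsPar : Atom → Set
  IsPar (var _) = ⊥
  IsPar (par _) = ⊤

  AllPar : Fm → Set
  AllPar (at a)   = IsPar a
  AllPar ⊥′       = ⊤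
  AllPar (A ∧′ B) = AllPar A × AllPar B
  AllPar (A ∨′ B) = AllPar A × AllPar B
  AllPar (A ⇒ B)  = AllPar A × AllPar B

  NNILpar : Fm → Set
  NNILpar E = NNIL E × AllPar E

  DownNNILpar : Fm → Set
  DownNNILpar E = Σ Subst λ θ → Projective E θ ×
                  Σ Fm λ E′ → NNILpar E′ × (⊢ sub θ E ⇔ E′)

  Pres : (Fm → Set) → Fm → Fm → Set
  Pres Γ A B = ∀ E → Γ E → ⊢ E ⇒ A → ⊢ E ⇒ B

  Adm : (Fm → Set) → Fm → Fm → Set
  Adm Γ A B = ∀ (θ : Subst) C → Γ C → ⊢ sub θ (C ⇒ A) → ⊢ sub θ (C ⇒ B)

{-# OPTIONS --safe #-}

-- From admissibility to preservativity: if θ is E-projective and θ(E) is equivalent to E′, apply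
-- admissibility to θ and E′ and go back from θ(B) to B over E.
--
-- Conversely, let C ⊢ θ(A) with C over the parameters. It suffices to find a projective E ⊢ A with
-- C ⊢ θ(E) whose projective substitution σ satisfies ⊢ σ(E) ↔ C: then E ⊢ B, so C ⊢ θ(B).
-- Let S be the set of subformulas of A ∧ C, and call a sign assignment m to S good if C does not
-- prove θ(⋀ m⁺ → ⋁ m⁻). Take for E the conjunction of ⋀ m⁺ → ⋁ m⁻ over all m that are not good.
-- As in Ghilardi's theorem, σ is an iterated composition of the substitutions x ↦ E → x or
-- x ↦ E ∧ x, one for each valuation of the variables. If E fails throughout a part of a finite
-- Kripke tree whose worlds see the same types satisfying E, glue countermodels witnessing that
-- these types are good under a new root; whether θ(x) holds at that root is the valuation making
-- E true on this part. The implications in S hold at the root of the glued model exactly when they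
-- do at the original worlds, so no bisimulation or extension of the language is needed.

module Submission where

open import Defs
open import Data.Bool using (Bool; true; false; if_then_else_)
import Data.Bool.Properties as Bool
open import Data.Empty using (⊥; ⊥-elim)
open import Data.Fin using (Fin)
import Data.Fin.Properties as Fin
open import Data.List using (List; []; _∷_; _++_; map; filter; foldr; length; allFin)
open import Data.List.Membership.Propositional using (_∈_)
open import Data.List.Membership.Propositional.Properties
  using (∈-map⁺; ∈-map⁻; ∈-++⁺ˡ; ∈-++⁺ʳ; ∈-++⁻; ∈-allFin; ∈-filter⁺; ∈-map∘filter⁺; ∈-map∘filter⁻)
open import Data.List.Properties using (length-filter)
open import Data.List.Relation.Binary.Permutation.Propositional using (_↭_; ↭-sym)
open import Data.List.Relation.Binary.Permutation.Propositional.Properties using (shift; ∈-resp-↭; ++-comm)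
open import Data.List.Relation.Binary.Subset.Propositional using (_⊆_)
open import Data.List.Relation.Binary.Subset.Propositional.Properties using (∷⁺ʳ)
import Data.List.Relation.Unary.All as All
open import Data.List.Relation.Unary.Any using (here; there; any?)
open import Data.Nat using (ℕ; zero; suc; _≤_; _<_; _<?_; z≤n; s≤s; s≤s⁻¹)
open import Data.Nat.Properties using (≤-refl; ≤-trans; m≤n⇒m≤1+n; <-≤-trans; <⇒≱; ≮⇒≥)
open import Data.Product using (Σ; _×_; _,_; proj₁; proj₂)
open import Data.Sum using (_⊎_; inj₁; inj₂)
import Data.Sum as Sum
open import Data.Unit using (⊤; tt)
open import Data.Vec using (Vec; []; _∷_; lookup; tabulate)
open import Data.Vec.Properties using (lookup∘tabulate)
open import Function using (_∘_; id)
open import Relation.Binary.PropositionalEquality using (_≡_; refl; sym; trans; cong; cong₂; subst)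
open import Relation.Nullary using (¬_; Dec; yes; no; does; contradiction)
open import Relation.Nullary.Decidable
  using (¬?; decidable-stable; dec-true; dec-false; _×-dec_; _⊎-dec_; _→-dec_; map′)

-- Finite case distinctions over lists

infix 1 _↔_
_↔_ : Set → Set → Set
X ↔ Y = (X → Y) × (Y → X)

all-or : {X Y : Set} {Q : X → Set} (L : List X) →
         (∀ x → x ∈ L → Y ⊎ Q x) → Y ⊎ (∀ x → x ∈ L → Q x)
all-or []      h = inj₂ λ _ ()
all-or (x ∷ L) h with h x (here refl) | all-or L (λ y y∈ → h y (there y∈))
... | inj₁ y | _       = inj₁ y
... | inj₂ _ | inj₁ y  = inj₁ y
... | inj₂ q | inj₂ qs = inj₂ λ { _ (here refl) → q ; y (there y∈) → qs y y∈ }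

-- Used to choose the finitely many trees put over a new root. The last clause lets nothing but
-- chosen witnesses into the list, so what holds of witnesses holds of all its members.
collect : {X T : Set} {P : X → Set} {Q : X → T → Set} (L : List X) →
          (∀ x → x ∈ L → P x ⊎ Σ T (Q x)) →
          Σ (List T) λ ts → (∀ x → x ∈ L → P x ⊎ Σ T λ t → t ∈ ts × Q x t)
                          × (∀ t → t ∈ ts → Σ X λ x → x ∈ L × Q x t)
collect []      h = [] , (λ _ ()) , λ _ ()
collect (x ∷ L) h with h x (here refl) | collect L (λ y y∈ → h y (there y∈))
... | inj₁ p       | ts , f , g =
  ts , (λ { _ (here refl) → inj₁ p ; y (there y∈) → f y y∈ }) ,
  λ t t∈ → let (y , y∈ , q) = g t t∈ in y , there y∈ , q
... | inj₂ (t , q) | ts , f , g =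
  t ∷ ts ,
  (λ { _ (here refl) → inj₂ (t , here refl , q)
     ; y (there y∈) → grow (f y y∈) }) ,
  λ { _ (here refl) → x , here refl , q
    ; s (there s∈) → let (y , y∈ , q′) = g s s∈ in y , there y∈ , q′ }
  where
  grow : ∀ {Y : Set} {R : _ → Set} → Y ⊎ (Σ _ λ s → s ∈ ts × R s) → Y ⊎ (Σ _ λ s → s ∈ t ∷ ts × R s)
  grow (inj₁ y)            = inj₁ y
  grow (inj₂ (s , s∈ , r)) = inj₂ (s , there s∈ , r)

module _ (nv np : ℕ) where
  open IPC nv np

  -- Weakening and substitution in derivations

  weaken : ∀ {Γ Δ A} → Γ ⊆ Δ → Γ ⊢ A → Δ ⊢ A
  weaken w (hyp x)     = hyp (w x)
  weaken w (⊥E d)      = ⊥E (weaken w d)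
  weaken w (∧I d e)    = ∧I (weaken w d) (weaken w e)
  weaken w (∧E₁ d)     = ∧E₁ (weaken w d)
  weaken w (∧E₂ d)     = ∧E₂ (weaken w d)
  weaken w (∨I₁ d)     = ∨I₁ (weaken w d)
  weaken w (∨I₂ d)     = ∨I₂ (weaken w d)
  weaken w (∨E d e f)  = ∨E (weaken w d) (weaken (∷⁺ʳ _ w) e) (weaken (∷⁺ʳ _ w) f)
  weaken w (⇒I d)      = ⇒I (weaken (∷⁺ʳ _ w) d)
  weaken w (⇒E d e)    = ⇒E (weaken w d) (weaken w e)

  sub-⊢ : ∀ σ {Γ A} → Γ ⊢ A → map (sub σ) Γ ⊢ sub σ A
  sub-⊢ σ (hyp x)     = hyp (∈-map⁺ (sub σ) x)
  sub-⊢ σ (⊥E d)      = ⊥E (sub-⊢ σ d)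
  sub-⊢ σ (∧I d e)    = ∧I (sub-⊢ σ d) (sub-⊢ σ e)
  sub-⊢ σ (∧E₁ d)     = ∧E₁ (sub-⊢ σ d)
  sub-⊢ σ (∧E₂ d)     = ∧E₂ (sub-⊢ σ d)
  sub-⊢ σ (∨I₁ d)     = ∨I₁ (sub-⊢ σ d)
  sub-⊢ σ (∨I₂ d)     = ∨I₂ (sub-⊢ σ d)
  sub-⊢ σ (∨E d e f)  = ∨E (sub-⊢ σ d) (sub-⊢ σ e) (sub-⊢ σ f)
  sub-⊢ σ (⇒I d)      = ⇒I (sub-⊢ σ d)
  sub-⊢ σ (⇒E d e)    = ⇒E (sub-⊢ σ d) (sub-⊢ σ e)

  ⊢-deduce : ∀ {A B} → ⊢ A ⇒ B → A ∷ [] ⊢ B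
  ⊢-deduce d = ⇒E (weaken (λ ()) d) (hyp (here refl))

  chain : ∀ {A B C} → ⊢ A ⇒ B → ⊢ B ⇒ C → ⊢ A ⇒ C
  chain d e = ⇒I (⇒E (weaken (λ ()) e) (⊢-deduce d))

  sub-par : ∀ σ {A} → AllPar A → sub σ A ≡ A
  sub-par σ {at (par j)} _       = refl
  sub-par σ {⊥′}         _       = refl
  sub-par σ {A ∧′ B}     (a , b) = cong₂ _∧′_ (sub-par σ a) (sub-par σ b)
  sub-par σ {A ∨′ B}     (a , b) = cong₂ _∨′_ (sub-par σ a) (sub-par σ b)
  sub-par σ {A ⇒ B}      (a , b) = cong₂ _⇒_ (sub-par σ a) (sub-par σ b)

  ⋀ ⋁ : List Fm → Fm
  ⋀ = foldr _∧′_ ⊤′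
  ⋁ = foldr _∨′_ ⊥′

  ⋁-intro : ∀ {Γ Δ D} → D ∈ Δ → Γ ⊢ D → Γ ⊢ ⋁ Δ
  ⋁-intro (here refl) d = ∨I₁ d
  ⋁-intro (there D∈)  d = ∨I₂ (⋁-intro D∈ d)

  -- Finite Kripke trees

  data Tree : Set where
    node : (Atom → Bool) → List Tree → Tree

  val : Tree → Atom → Bool
  val (node v _) = v

  infix 3 _≼_ _⊩_

  -- Worlds are the subtrees themselves, so a world is again a rooted model.
  data _≼_ : Tree → Tree → Set where
    root  : ∀ {t} → t ≼ t
    child : ∀ {v ts s u} → s ∈ ts → s ≼ u → node v ts ≼ u

  ≼-trans : ∀ {t s u} → t ≼ s → s ≼ u → t ≼ u
  ≼-trans root        q = q
  ≼-trans (child i p) q = child i (≼-trans p q)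

  somewhere? : ∀ {P : Tree → Set} → (∀ s → Dec (P s)) → ∀ t → Dec (Σ Tree λ s → t ≼ s × P s)
  somewhereIn? : ∀ {P : Tree → Set} → (∀ s → Dec (P s)) → ∀ ts →
                 Dec (Σ Tree λ c → c ∈ ts × Σ Tree λ s → c ≼ s × P s)
  somewhere? {P} P? (node v ts) =
    map′ (λ { (inj₁ p) → _ , root , p ; (inj₂ (c , c∈ , s , c≼s , p)) → s , child c∈ c≼s , p })
         (λ { (_ , root , p) → inj₁ p ; (s , child c∈ c≼s , p) → inj₂ (_ , c∈ , s , c≼s , p) })
         (P? (node v ts) ⊎-dec somewhereIn? {P} P? ts)
  somewhereIn? P? []       = no λ { (_ , () , _) }
  somewhereIn? {P} P? (t ∷ ts) =
    map′ (λ { (inj₁ q) → t , here refl , q ; (inj₂ (c , c∈ , q)) → c , there c∈ , q })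
         (λ { (_ , here refl , q) → inj₁ q ; (c , there c∈ , q) → inj₂ (c , c∈ , q) })
         (somewhere? {P} P? t ⊎-dec somewhereIn? {P} P? ts)

  everywhere? : ∀ {P : Tree → Set} → (∀ s → Dec (P s)) → ∀ t → Dec (∀ {s} → t ≼ s → P s)
  everywhere? P? t =
    map′ (λ ¬s {s} t≼s → decidable-stable (P? s) λ ¬p → ¬s (s , t≼s , ¬p))
         (λ h (s , t≼s , ¬p) → ¬p (h t≼s))
         (¬? (somewhere? (λ s → ¬? (P? s)) t))

  -- Atoms quantify over the whole cone, which makes forcing monotone for arbitrary valuations.
  _⊩_ : Tree → Fm → Set
  t ⊩ at a   = ∀ {s} → t ≼ s → val s a ≡ true
  t ⊩ ⊥′     = true ≡ false
  t ⊩ A ∧′ B = (t ⊩ A) × (t ⊩ B)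
  t ⊩ A ∨′ B = (t ⊩ A) ⊎ (t ⊩ B)
  t ⊩ A ⇒ B  = ∀ {s} → t ≼ s → s ⊩ A → s ⊩ B

  _⊩?_ : ∀ t A → Dec (t ⊩ A)
  t ⊩? at a     = everywhere? (λ s → val s a Bool.≟ true) t
  t ⊩? ⊥′       = no λ ()
  t ⊩? (A ∧′ B) = (t ⊩? A) ×-dec (t ⊩? B)
  t ⊩? (A ∨′ B) = (t ⊩? A) ⊎-dec (t ⊩? B)
  t ⊩? (A ⇒ B)  = everywhere? (λ s → (s ⊩? A) →-dec (s ⊩? B)) t

  mono : ∀ A {t s} → t ≼ s → t ⊩ A → s ⊩ A
  mono (at a)   p f        = λ q → f (≼-trans p q)
  mono ⊥′       p ()
  mono (A ∧′ B) p (f , g)  = mono A p f , mono B p g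
  mono (A ∨′ B) p (inj₁ f) = inj₁ (mono A p f)
  mono (A ∨′ B) p (inj₂ f) = inj₂ (mono B p f)
  mono (A ⇒ B)  p f        = λ q → f (≼-trans p q)

  extend : ∀ {Γ A t} → (∀ {D} → D ∈ Γ → t ⊩ D) → t ⊩ A → ∀ {D} → D ∈ A ∷ Γ → t ⊩ D
  extend g a (here refl) = a
  extend g a (there D∈)  = g D∈

  sound : ∀ {Γ A} → Γ ⊢ A → ∀ {t} → (∀ {D} → D ∈ Γ → t ⊩ D) → t ⊩ A
  sound (hyp x)    g = g x
  sound (⊥E d)     g = contradiction (sound d g) λ ()
  sound (∧I d e)   g = sound d g , sound e g
  sound (∧E₁ d)    g = proj₁ (sound d g)
  sound (∧E₂ d)    g = proj₂ (sound d g)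
  sound (∨I₁ d)    g = inj₁ (sound d g)
  sound (∨I₂ d)    g = inj₂ (sound d g)
  sound (∨E d e f) g with sound d g
  ... | inj₁ a = sound e (extend g a)
  ... | inj₂ b = sound f (extend g b)
  sound (⇒I d)     g = λ p a → sound d (extend (λ {D} D∈ → mono D p (g D∈)) a)
  sound (⇒E d e)   g = sound d g root (sound e g)

  -- Types: sign assignments to a list of formulas

  Type : Set
  Type = List (Fm × Bool)

  support : Type → List Fm
  support = map proj₁

  signed : Bool → Type → List Fm
  signed b m = map proj₁ (filter (λ e → proj₂ e Bool.≟ b) m)

  signed⁺ : ∀ {b m D} → (D , b) ∈ m → D ∈ signed b m
  signed⁺ {b} i = ∈-map∘filter⁺ proj₁ (λ e → proj₂ e Bool.≟ b) (_ , i , refl , refl)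

  signed⁻ : ∀ {b m D} → D ∈ signed b m → (D , b) ∈ m
  signed⁻ {b} i with ∈-map∘filter⁻ proj₁ (λ e → proj₂ e Bool.≟ b) i
  ... | _ , j , refl , refl = j

  Sign : Bool → Set → Set
  Sign true  X = X
  Sign false X = ¬ X

  Sign? : ∀ b {X} → Dec X → Dec (Sign b X)
  Sign? true  d = d
  Sign? false d = ¬? d

  Signs : (Fm → Set) → Type → Set
  Signs P m = ∀ {D b} → (D , b) ∈ m → Sign b (P D)

  Signs? : ∀ {P} → (∀ D → Dec (P D)) → ∀ m → Dec (Signs P m)
  Signs? P? m = map′ (λ a i → All.lookup a i) (λ s → All.tabulate s)
                     (All.all? (λ e → Sign? (proj₂ e) (P? (proj₁ e))) m)

  Signs-intro : ∀ {P : Fm → Set} {m} → (∀ {D} → D ∈ signed true m → P D) →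
                (∀ {D} → D ∈ signed false m → ¬ P D) → Signs P m
  Signs-intro f g {b = true}  i = f (signed⁺ i)
  Signs-intro f g {b = false} i = g (signed⁺ i)

  -- The types open to a world over one of type `m`: positive entries persist, negative ones may
  -- turn positive.
  above : Type → List Type
  above []                = [] ∷ []
  above ((D , true)  ∷ m) = map ((D , true) ∷_) (above m)
  above ((D , false) ∷ m) = map ((D , true) ∷_) (above m) ++ map ((D , false) ∷_) (above m)

  infix 3 _⊑_
  data _⊑_ : Type → Type → Set where
    []    : [] ⊑ []
    keep  : ∀ {e m m′} → m ⊑ m′ → e ∷ m ⊑ e ∷ m′
    raise : ∀ {D m m′} → m ⊑ m′ → (D , false) ∷ m ⊑ (D , true) ∷ m′

  above⇒⊑ : ∀ m {m′} → m′ ∈ above m → m ⊑ m′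
  above⇒⊑ [] (here refl) = []
  above⇒⊑ ((D , true) ∷ m) i with ∈-map⁻ _ i
  ... | _ , j , refl = keep (above⇒⊑ m j)
  above⇒⊑ ((D , false) ∷ m) i with ∈-++⁻ (map ((D , true) ∷_) (above m)) i
  ... | inj₁ i′ with ∈-map⁻ _ i′
  ...   | _ , j , refl = raise (above⇒⊑ m j)
  above⇒⊑ ((D , false) ∷ m) i | inj₂ i′ with ∈-map⁻ _ i′
  ...   | _ , j , refl = keep (above⇒⊑ m j)

  ⊑-support : ∀ {m m′} → m ⊑ m′ → support m′ ≡ support m
  ⊑-support []        = refl
  ⊑-support (keep p)  = cong (_ ∷_) (⊑-support p)
  ⊑-support (raise p) = cong (_ ∷_) (⊑-support p)

  ⊑-true : ∀ {m m′ D} → m ⊑ m′ → (D , true) ∈ m → (D , true) ∈ m′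
  ⊑-true (keep p)  (here refl) = here refl
  ⊑-true (keep p)  (there i)   = there (⊑-true p i)
  ⊑-true (raise p) (there i)   = there (⊑-true p i)

  negs : Type → ℕ
  negs m = length (signed false m)

  ⊑-negs : ∀ {m m′} → m ⊑ m′ → negs m′ ≤ negs m
  ⊑-negs []                     = z≤n
  ⊑-negs (keep {_ , true} p)    = ⊑-negs p
  ⊑-negs (keep {_ , false} p)   = s≤s (⊑-negs p)
  ⊑-negs (raise p)              = m≤n⇒m≤1+n (⊑-negs p)

  -- A newly positive entry was negative before, so `negs` drops; this is what lets the search for
  -- countermodels terminate.
  ⊑-new : ∀ {m m′ D} → m ⊑ m′ → (D , true) ∈ m′ → (D , true) ∈ m ⊎ negs m′ < negs m
  ⊑-new (raise p) i           = inj₂ (s≤s (⊑-negs p))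
  ⊑-new (keep p)  (here refl) = inj₁ (here refl)
  ⊑-new (keep {_ , b} p) (there i) with b | ⊑-new p i
  ... | _     | inj₁ j = inj₁ (there j)
  ... | true  | inj₂ l = inj₂ l
  ... | false | inj₂ l = inj₂ (s≤s l)

  -- Iterated cut along `m`. A positive entry stays a hypothesis. For a negative `D`, the types
  -- keeping it negative give `B ∨′ D`, and those making it positive settle the case `D`.
  split : ∀ m {Γ B} → (∀ m′ → m′ ∈ above m → signed true m′ ++ Γ ⊢ B ∨′ ⋁ (signed false m′)) →
          signed true m ++ Γ ⊢ B
  split [] h = ∨E (h [] (here refl)) (hyp (here refl)) (⊥E (hyp (here refl)))
  split ((D , true) ∷ m) {Γ} h =
    weaken (∈-resp-↭ (shift D (signed true m) Γ))
      (split m λ m′ i → weaken (∈-resp-↭ (↭-sym (shift D (signed true m′) Γ))) (h _ (∈-map⁺ _ i)))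
  split ((D , false) ∷ m) {Γ} {B} h =
    ∨E (split m {B = B ∨′ D} λ m′ i → assoc (h _ (∈-++⁺ʳ (map _ (above m)) (∈-map⁺ _ i))))
       (hyp (here refl))
       (weaken (∈-resp-↭ (shift D (signed true m) Γ))
         (split m λ m′ i → weaken (∈-resp-↭ (↭-sym (shift D (signed true m′) Γ)))
                                  (h _ (∈-++⁺ˡ (∈-map⁺ _ i)))))
    where
    assoc : ∀ {Δ X Y Z} → Δ ⊢ X ∨′ (Y ∨′ Z) → Δ ⊢ (X ∨′ Y) ∨′ Z
    assoc d = ∨E d (∨I₁ (∨I₁ (hyp (here refl))))
                   (∨E (hyp (here refl)) (∨I₁ (∨I₂ (hyp (here refl)))) (∨I₂ (hyp (here refl))))

  opaque
    -- All sign assignments to `S`: each lies above the all-negative one.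
    signings : List Fm → List Type
    signings S = above (map (_, false) S)

    signings-support : ∀ {S m} → m ∈ signings S → support m ≡ S
    signings-support {S} i = trans (⊑-support (above⇒⊑ _ i)) (lemma S)
      where
      lemma : ∀ S → support (map (_, false) S) ≡ S
      lemma []      = refl
      lemma (D ∷ S) = cong (D ∷_) (lemma S)

    signings-exist : ∀ {P} → (∀ D → Dec (P D)) → ∀ S → Σ Type λ m → m ∈ signings S × Signs P m
    signings-exist P? []      = [] , here refl , λ ()
    signings-exist P? (D ∷ S) with signings-exist P? S | P? D
    ... | m , i , s | yes p = (D , true) ∷ m , ∈-++⁺ˡ (∈-map⁺ _ i) ,
      λ { (here refl) → p ; (there j) → s j }
    ... | m , i , s | no ¬p = (D , false) ∷ m , ∈-++⁺ʳ (map _ (signings S)) (∈-map⁺ _ i) ,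
      λ { (here refl) → ¬p ; (there j) → s j }

    split-signings : ∀ S {B} → (∀ m → m ∈ signings S → signed true m ++ [] ⊢ B ∨′ ⋁ (signed false m)) → ⊢ B
    split-signings S h = weaken (noPositives S) (split (map (_, false) S) h)
      where
      noPositives : ∀ S → signed true (map (_, false) S) ++ [] ⊆ []
      noPositives (_ ∷ S) = noPositives S

  sign-of : ∀ {m S D} → support m ≡ S → D ∈ S → Σ Bool λ b → (D , b) ∈ m
  sign-of refl i with ∈-map⁻ proj₁ i
  ... | (_ , b) , j , refl = b , j

  entry∈ : ∀ {m S D b} → support m ≡ S → (D , b) ∈ m → D ∈ S
  entry∈ refl i = ∈-map⁺ proj₁ i

  agree : ∀ {P Q : Fm → Set} {m S D} → support m ≡ S → Signs P m → Signs Q m → D ∈ S → P D ↔ Q D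
  agree e p q i with sign-of e i
  ... | true  , j = (λ _ → q j) , (λ _ → p j)
  ... | false , j = (λ x → contradiction x (p j)) , (λ x → contradiction x (q j))

  -- Lists closed under subformulas

  Components : List Fm → Fm → Set
  Components S (A ∧′ B) = A ∈ S × B ∈ S
  Components S (A ∨′ B) = A ∈ S × B ∈ S
  Components S (A ⇒ B)  = A ∈ S × B ∈ S
  Components S _        = ⊤

  Closed : List Fm → Set
  Closed S = ∀ {D} → D ∈ S → Components S D

  subs properSubs : Fm → List Fm
  subs A = A ∷ properSubs A
  properSubs (A ∧′ B) = subs A ++ subs B
  properSubs (A ∨′ B) = subs A ++ subs B
  properSubs (A ⇒ B)  = subs A ++ subs B
  properSubs _        = []

  Components-⊆ : ∀ {S S′} D → S ⊆ S′ → Components S D → Components S′ D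
  Components-⊆ (at _)   f c       = tt
  Components-⊆ ⊥′       f c       = tt
  Components-⊆ (_ ∧′ _) f (a , b) = f a , f b
  Components-⊆ (_ ∨′ _) f (a , b) = f a , f b
  Components-⊆ (_ ⇒ _)  f (a , b) = f a , f b

  ++-Closed : ∀ {S S′} → Closed S → Closed S′ → Closed (S ++ S′)
  ++-Closed {S} c c′ {D} i with ∈-++⁻ S i
  ... | inj₁ j = Components-⊆ D ∈-++⁺ˡ (c j)
  ... | inj₂ j = Components-⊆ D (∈-++⁺ʳ S) (c′ j)

  subs-Closed : ∀ G → Closed (subs G)
  subs-Closed (at _)   (here refl) = tt
  subs-Closed ⊥′       (here refl) = tt
  subs-Closed (A ∧′ B) (here refl) = there (here refl) , there (∈-++⁺ʳ (subs A) (here refl))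
  subs-Closed (A ∨′ B) (here refl) = there (here refl) , there (∈-++⁺ʳ (subs A) (here refl))
  subs-Closed (A ⇒ B)  (here refl) = there (here refl) , there (∈-++⁺ʳ (subs A) (here refl))
  subs-Closed (A ∧′ B) {D} (there i) = Components-⊆ D there (++-Closed (subs-Closed A) (subs-Closed B) i)
  subs-Closed (A ∨′ B) {D} (there i) = Components-⊆ D there (++-Closed (subs-Closed A) (subs-Closed B) i)
  subs-Closed (A ⇒ B)  {D} (there i) = Components-⊆ D there (++-Closed (subs-Closed A) (subs-Closed B) i)

  -- Completeness for finite trees

  -- Inconsistency of `m`: by soundness no world has such a type.
  Refutable : Type → Set
  Refutable m = signed true m ⊢ ⋁ (signed false m)

  refute : ∀ {m D} → (D , false) ∈ m → signed true m ⊢ D → Refutable m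
  refute i d = ⋁-intro (signed⁺ i) d

  assume : ∀ {m D} → (D , true) ∈ m → signed true m ⊢ D
  assume i = hyp (signed⁺ i)

  _≟Atom_ : (a b : Atom) → Dec (a ≡ b)
  var i ≟Atom var j = map′ (cong var) (λ { refl → refl }) (i Fin.≟ j)
  var i ≟Atom par j = no λ ()
  par i ≟Atom var j = no λ ()
  par i ≟Atom par j = map′ (cong par) (λ { refl → refl }) (i Fin.≟ j)

  at? : ∀ a (D : Fm) → Dec (at a ≡ D)
  at? a (at b)   = map′ (cong at) (λ { refl → refl }) (a ≟Atom b)
  at? a ⊥′       = no λ ()
  at? a (_ ∧′ _) = no λ ()
  at? a (_ ∨′ _) = no λ ()
  at? a (_ ⇒ _)  = no λ ()

  module Saturation (S : List Fm) (closed : Closed S) where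

    module Node (m : Type) (supp : support m ≡ S) (cs : List Tree)
                (persist : ∀ t → t ∈ cs → ∀ {D} → (D , true) ∈ m → t ⊩ D) where

      infix 3 _∈⁺ _∈⁻
      _∈⁺ _∈⁻ : Fm → Set
      D ∈⁺ = (D , true) ∈ m
      D ∈⁻ = (D , false) ∈ m

      atom? : ∀ a → Dec (at a ∈ signed true m)
      atom? a = any? (at? a) (signed true m)

      tree : Tree
      tree = node (λ a → does (atom? a)) cs

      -- Hintikka's conditions on `m` as the type of a new root below `cs`. Only negative
      -- implications look at the children. A formula may be listed twice with opposite signs, hence
      -- the condition on negative atoms.
      Local : Fm × Bool → Set
      Local (at a   , true)  = ⊤
      Local (at a   , false) = ¬ (at a ∈ signed true m)
      Local (⊥′     , true)  = ⊥
      Local (⊥′     , false) = ⊤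
      Local ((A ∧′ B) , true)  = (A ∈⁺) × (B ∈⁺)
      Local ((A ∧′ B) , false) = (A ∈⁻) ⊎ (B ∈⁻)
      Local ((A ∨′ B) , true)  = (A ∈⁺) ⊎ (B ∈⁺)
      Local ((A ∨′ B) , false) = (A ∈⁻) × (B ∈⁻)
      Local ((A ⇒ B) , true)  = (A ∈⁻) ⊎ (B ∈⁺)
      Local ((A ⇒ B) , false) = ((A ∈⁺) × (B ∈⁻)) ⊎ Σ Tree λ t → t ∈ cs × (t ⊩ A) × ¬ (t ⊩ B)

      -- Truth lemma, by induction on `D`. Above the root, positive atoms and implications are
      -- covered by `persist`.
      truth : (∀ e → e ∈ m → Local e) → ∀ D {b} → (D , b) ∈ m → Sign b (tree ⊩ D)
      truth ok (at a) {true} i root with atom? a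
      ... | yes _ = refl
      ... | no ¬p = contradiction (signed⁺ i) ¬p
      truth ok (at a) {true} i (child c q) = persist _ c i q
      truth ok (at a) {false} i f with atom? a | f root
      ... | yes p | _  = ok _ i p
      ... | no ¬p | ()
      truth ok ⊥′ {true}  i = ⊥-elim (ok _ i)
      truth ok ⊥′ {false} i = λ ()
      truth ok (A ∧′ B) {true} i with ok _ i
      ... | a , b = truth ok A a , truth ok B b
      truth ok (A ∧′ B) {false} i (f , g) with ok _ i
      ... | inj₁ a = truth ok A a f
      ... | inj₂ b = truth ok B b g
      truth ok (A ∨′ B) {true} i with ok _ i
      ... | inj₁ a = inj₁ (truth ok A a)
      ... | inj₂ b = inj₂ (truth ok B b)
      truth ok (A ∨′ B) {false} i f with ok _ i | f
      ... | a , b | inj₁ g = truth ok A a g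
      ... | a , b | inj₂ g = truth ok B b g
      truth ok (A ⇒ B) {true} i root f with ok _ i
      ... | inj₁ a = contradiction f (truth ok A a)
      ... | inj₂ b = truth ok B b
      truth ok (A ⇒ B) {true} i (child c q) f = persist _ c i q f
      truth ok (A ⇒ B) {false} i f with ok _ i
      ... | inj₁ (a , b)           = truth ok B b (f root (truth ok A a))
      ... | inj₂ (t , t∈ , a , ¬b) = ¬b (f (child t∈ root) a)

      module _ (successor : ∀ m′ → m′ ∈ above m →
                            (negs m′ < negs m → Refutable m′) ⊎ Σ Tree λ t → t ∈ cs × Signs (t ⊩_) m′) where

        -- If no child forces `A` without `B`, the types above `m` with `A` positive and `B`
        -- negative are refutable. Splitting over all types above `m` under the hypothesis `A` then
        -- derives `B`, and so the negative entry `A ⇒ B`.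
        implication : ∀ {A B} → A ∈⁻ → A ∈ S → B ∈ S → (A ⇒ B) ∈⁻ →
                      Refutable m ⊎ Σ Tree λ t → t ∈ cs × (t ⊩ A) × ¬ (t ⊩ B)
        implication {A} {B} a⁻ A∈ B∈ i with all-or (above m) step
          where
          step : ∀ m′ → m′ ∈ above m →
                 (Refutable m ⊎ Σ Tree λ t → t ∈ cs × (t ⊩ A) × ¬ (t ⊩ B)) ⊎
                 (signed true m′ ++ A ∷ [] ⊢ B ∨′ ⋁ (signed false m′))
          step m′ m′∈ with above⇒⊑ m m′∈
          ... | le with sign-of (trans (⊑-support le) supp) A∈ | sign-of (trans (⊑-support le) supp) B∈
          ...   | false , a | _ = inj₂ (∨I₂ (⋁-intro (signed⁺ a) (hyp (∈-++⁺ʳ (signed true m′) (here refl)))))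
          ...   | true , a | true , b = inj₂ (∨I₁ (hyp (∈-++⁺ˡ (signed⁺ b))))
          ...   | true , a | false , b with ⊑-new le a | successor m′ m′∈
          -- Here `A` has both signs in `m`.
          ...     | inj₁ a⁺ | _ = inj₁ (inj₁ (refute a⁻ (assume a⁺)))
          ...     | inj₂ lt | inj₁ r = inj₂ (∨I₂ (weaken ∈-++⁺ˡ (r lt)))
          ...     | inj₂ lt | inj₂ (t , t∈ , s) = inj₁ (inj₂ (t , t∈ , s a , s b))
        ... | inj₁ r = r
        ... | inj₂ h = inj₁ (refute i (⇒I (weaken (∈-resp-↭ comm) (split m h))))
          where
          comm : signed true m ++ A ∷ [] ↭ A ∷ signed true m
          comm = ++-comm (signed true m) (A ∷ [])

        local : ∀ e → e ∈ m → Refutable m ⊎ Local e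
        local (D , b) i with closed (entry∈ supp i)
        local (at a , true) i | _ = inj₂ tt
        local (at a , false) i | _ with atom? a
        ... | yes p = inj₁ (refute i (hyp p))
        ... | no ¬p = inj₂ ¬p
        local (⊥′ , true)  i | _ = inj₁ (⊥E (assume i))
        local (⊥′ , false) i | _ = inj₂ tt
        local ((A ∧′ B) , b) i | A∈ , B∈ with b | sign-of supp A∈ | sign-of supp B∈
        ... | true  | true , a  | true , b  = inj₂ (a , b)
        ... | true  | false , a | _         = inj₁ (refute a (∧E₁ (assume i)))
        ... | true  | _         | false , b = inj₁ (refute b (∧E₂ (assume i)))
        ... | false | true , a  | true , b  = inj₁ (refute i (∧I (assume a) (assume b)))
        ... | false | false , a | _         = inj₂ (inj₁ a)
        ... | false | _         | false , b = inj₂ (inj₂ b)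
        local ((A ∨′ B) , b) i | A∈ , B∈ with b | sign-of supp A∈ | sign-of supp B∈
        ... | true  | true , a  | _         = inj₂ (inj₁ a)
        ... | true  | _         | true , b  = inj₂ (inj₂ b)
        ... | true  | false , a | false , b =
          inj₁ (∨E (assume i) (⋁-intro (signed⁺ a) (hyp (here refl))) (⋁-intro (signed⁺ b) (hyp (here refl))))
        ... | false | true , a  | _         = inj₁ (refute i (∨I₁ (assume a)))
        ... | false | _         | true , b  = inj₁ (refute i (∨I₂ (assume b)))
        ... | false | false , a | false , b = inj₂ (a , b)
        local ((A ⇒ B) , b) i | A∈ , B∈ with b | sign-of supp A∈ | sign-of supp B∈
        ... | true  | false , a | _         = inj₂ (inj₁ a)
        ... | true  | _         | true , b  = inj₂ (inj₂ b)
        ... | true  | true , a  | false , b = inj₁ (refute b (⇒E (assume i) (assume a)))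
        ... | false | true , a  | false , b = inj₂ (inj₁ (a , b))
        ... | false | _         | true , b  = inj₁ (refute i (⇒I (weaken there (assume b))))
        ... | false | false , a | _ with implication a A∈ B∈ i
        ...   | inj₁ r = inj₁ r
        ...   | inj₂ w = inj₂ (inj₂ w)

    Realizable : Type → Set
    Realizable m = Σ Tree λ t → Signs (t ⊩_) m

    persistent : ∀ {m cs} → (∀ t → t ∈ cs → Σ Type λ m′ → m′ ∈ above m × Signs (t ⊩_) m′) →
                 ∀ t → t ∈ cs → ∀ {D} → (D , true) ∈ m → t ⊩ D
    persistent {m} origin t t∈ i = let (_ , m′∈ , s) = origin t t∈ in s (⊑-true (above⇒⊑ m m′∈) i)

    assemble : ∀ m → support m ≡ S → ∀ cs →
               (∀ m′ → m′ ∈ above m →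
                 (negs m′ < negs m → Refutable m′) ⊎ Σ Tree λ t → t ∈ cs × Signs (t ⊩_) m′) →
               (∀ t → t ∈ cs → Σ Type λ m′ → m′ ∈ above m × Signs (t ⊩_) m′) →
               Refutable m ⊎ Realizable m
    assemble m supp cs successor origin =
      Sum.map id (λ ok → tree , λ {D} → truth ok D) (all-or m (local successor))
      where open Node m supp cs (persistent origin)

    -- Induction on a bound for `negs`: the realizable types above `m` with fewer negative entries
    -- supply the children of the root.
    search : ∀ n m → support m ≡ S → negs m < n → Refutable m ⊎ Realizable m
    search (suc n) m supp (s≤s lt) =
      let (cs , successor , origin) = collect (above m) attempt in assemble m supp cs successor origin
      where
      attempt : ∀ m′ → m′ ∈ above m → (negs m′ < negs m → Refutable m′) ⊎ Realizable m′
      attempt m′ i with negs m′ <? negs m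
      -- A type with no fewer negative entries is not searched; what is asked of it holds vacuously.
      ... | no ¬l = inj₁ (λ l → contradiction l ¬l)
      ... | yes l with search n m′ (trans (⊑-support (above⇒⊑ m i)) supp) (<-≤-trans l lt)
      ...   | inj₁ r = inj₁ (λ _ → r)
      ...   | inj₂ w = inj₂ w

  -- Each type of the subformulas that makes `G` negative is searched for a model. If all are
  -- refutable, splitting over all types derives `G`.
  prove : ∀ G → ⊢ G ⊎ Σ Tree λ t → ¬ (t ⊩ G)
  prove G with all-or (signings (subs G)) decide
    where
    open Saturation (subs G) (subs-Closed G)
    decide : ∀ m → m ∈ signings (subs G) →
             (Σ Tree λ t → ¬ (t ⊩ G)) ⊎ (signed true m ++ [] ⊢ G ∨′ ⋁ (signed false m))
    decide m i with sign-of {S = subs G} (signings-support {subs G} i) (here refl)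
    ... | true , g = inj₂ (∨I₁ (hyp (∈-++⁺ˡ (signed⁺ g))))
    ... | false , g with search (suc (negs m)) m (signings-support i) ≤-refl
    ...   | inj₁ r       = inj₂ (∨I₂ (weaken ∈-++⁺ˡ r))
    ...   | inj₂ (t , s) = inj₁ (t , s g)
  ... | inj₁ w = inj₂ w
  ... | inj₂ h = inj₁ (split-signings (subs G) h)

  complete : ∀ {G} → (∀ t → t ⊩ G) → ⊢ G
  complete {G} h with prove G
  ... | inj₁ d        = d
  ... | inj₂ (t , ¬g) = contradiction (h t) ¬g

  opaque
    provable? : ∀ G → Dec (⊢ G)
    provable? G with prove G
    ... | inj₁ d        = yes d
    ... | inj₂ (t , ¬g) = no λ d → ¬g (sound d λ ())

  ⊩⇒⊢ : ∀ {A B} → (∀ {t} → t ⊩ A → t ⊩ B) → ⊢ A ⇒ B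
  ⊩⇒⊢ h = complete λ t {s} _ → h {s}

  -- Substitutions on trees

  ⋀-intro : ∀ τ {Γ t} → (∀ {D} → D ∈ Γ → t ⊩ sub τ D) → t ⊩ sub τ (⋀ Γ)
  ⋀-intro τ {[]}    h = λ _ x → x
  ⋀-intro τ {D ∷ Γ} h = h (here refl) , ⋀-intro τ (λ i → h (there i))

  ⋀-elim : ∀ τ {Γ t D} → t ⊩ sub τ (⋀ Γ) → D ∈ Γ → t ⊩ sub τ D
  ⋀-elim τ (d , _)  (here refl) = d
  ⋀-elim τ (_ , ds) (there i)   = ⋀-elim τ ds i

  ⋁-⊩⁺ : ∀ τ {Δ t D} → D ∈ Δ → t ⊩ sub τ D → t ⊩ sub τ (⋁ Δ)
  ⋁-⊩⁺ τ (here refl) d = inj₁ d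
  ⋁-⊩⁺ τ (there i)   d = inj₂ (⋁-⊩⁺ τ i d)

  ⋁-⊩⁻ : ∀ τ {Δ t} → t ⊩ sub τ (⋁ Δ) → Σ Fm λ D → D ∈ Δ × t ⊩ sub τ D
  ⋁-⊩⁻ τ {D ∷ Δ} (inj₁ d)  = D , here refl , d
  ⋁-⊩⁻ τ {D ∷ Δ} (inj₂ ds) = let (D′ , i , d) = ⋁-⊩⁻ τ ds in D′ , there i , d

  sub-agree : ∀ {τ τ′ t} → (∀ {s} → t ≼ s → ∀ x → s ⊩ τ x ↔ s ⊩ τ′ x) →
              ∀ D → t ⊩ sub τ D ↔ t ⊩ sub τ′ D
  sub-agree h (at (var x)) = h root x
  sub-agree h (at (par j)) = id , id
  sub-agree h ⊥′           = id , id
  sub-agree h (A ∧′ B) with sub-agree h A | sub-agree h B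
  ... | f , f′ | g , g′ = (λ (a , b) → f a , g b) , λ (a , b) → f′ a , g′ b
  sub-agree h (A ∨′ B) with sub-agree h A | sub-agree h B
  ... | f , f′ | g , g′ = Sum.map f g , Sum.map f′ g′
  sub-agree {τ} {τ′} {t} h (A ⇒ B) = to , from
    where
    to : t ⊩ sub τ (A ⇒ B) → t ⊩ sub τ′ (A ⇒ B)
    to f p a = proj₁ (sub-agree (λ q → h (≼-trans p q)) B)
                 (f p (proj₂ (sub-agree (λ q → h (≼-trans p q)) A) a))
    from : t ⊩ sub τ′ (A ⇒ B) → t ⊩ sub τ (A ⇒ B)
    from f p a = proj₂ (sub-agree (λ q → h (≼-trans p q)) B)
                   (f p (proj₁ (sub-agree (λ q → h (≼-trans p q)) A) a))

  idS : Subst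
  idS x = at (var x)

  sub-id : ∀ D → sub idS D ≡ D
  sub-id (at (var x)) = refl
  sub-id (at (par j)) = refl
  sub-id ⊥′           = refl
  sub-id (A ∧′ B)     = cong₂ _∧′_ (sub-id A) (sub-id B)
  sub-id (A ∨′ B)     = cong₂ _∨′_ (sub-id A) (sub-id B)
  sub-id (A ⇒ B)      = cong₂ _⇒_ (sub-id A) (sub-id B)

  -- Forced at a world exactly when no world at or above it has type `m`.
  seqt : Type → Fm
  seqt m = ⋀ (signed true m) ⇒ ⋁ (signed false m)

  signs⇒refutes : ∀ {τ t m} → Signs (λ D → t ⊩ sub τ D) m → ¬ (t ⊩ sub τ (seqt m))
  signs⇒refutes {τ} s f with ⋁-⊩⁻ τ (f root (⋀-intro τ λ i → s (signed⁻ i)))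
  ... | _ , i , d = s (signed⁻ i) d

  refutes⇒signs : ∀ {τ t m} → t ⊩ sub τ (⋀ (signed true m)) → ¬ (t ⊩ sub τ (⋁ (signed false m))) →
                  Signs (λ D → t ⊩ sub τ D) m
  refutes⇒signs {τ} p n = Signs-intro (λ i → ⋀-elim τ p i) (λ i d → n (⋁-⊩⁺ τ i d))

  module _ {X : Set} {P Q : X → Set} (P? : ∀ x → Dec (P x)) (Q? : ∀ x → Dec (Q x))
           (P⇒Q : ∀ {x} → P x → Q x) where

    filter-mono : ∀ L → length (filter P? L) ≤ length (filter Q? L)
    filter-mono []      = z≤n
    filter-mono (x ∷ L) with P? x | Q? x
    ... | yes p | yes q = s≤s (filter-mono L)
    ... | yes p | no ¬q = contradiction (P⇒Q p) ¬q
    ... | no ¬p | yes q = m≤n⇒m≤1+n (filter-mono L)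
    ... | no ¬p | no ¬q = filter-mono L

    -- As `P` is contained in `Q`, equal counts force equality. This turns equal numbers of marks
    -- into equal sets of marks.
    filter-tight : ∀ L → length (filter Q? L) ≤ length (filter P? L) → ∀ {x} → x ∈ L → Q x → P x
    filter-tight (x ∷ L) le i q with P? x | Q? x
    filter-tight (x ∷ L) le (here refl) q | yes p | _      = p
    filter-tight (x ∷ L) le (here refl) q | no ¬p | no ¬q  = contradiction q ¬q
    filter-tight (x ∷ L) le i           q | no ¬p | yes _  =
      contradiction (≤-trans le (filter-mono L)) (<⇒≱ ≤-refl)
    filter-tight (x ∷ L) le (there i)   q | yes p | yes _  = filter-tight L (s≤s⁻¹ le) i q
    filter-tight (x ∷ L) le (there i)   q | yes p | no ¬q  = contradiction (P⇒Q p) ¬q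
    filter-tight (x ∷ L) le (there i)   q | no ¬p | no _   = filter-tight L le i q

  valuations : ∀ n → List (Vec Bool n)
  valuations zero    = [] ∷ []
  valuations (suc n) = map (true ∷_) (valuations n) ++ map (false ∷_) (valuations n)

  ∈-valuations : ∀ {n} (a : Vec Bool n) → a ∈ valuations n
  ∈-valuations []          = here refl
  ∈-valuations (true ∷ a)  = ∈-++⁺ˡ (∈-map⁺ _ (∈-valuations a))
  ∈-valuations (false ∷ a) = ∈-++⁺ʳ (map _ (valuations _)) (∈-map⁺ _ (∈-valuations a))

  -- Projective approximation

  module Approximation (A C : Fm) (θ : Subst) (par-C : AllPar C) (C⊢θA : ⊢ C ⇒ sub θ A) where

    S : List Fm
    S = subs (A ∧′ C)

    Bad : Type → Set
    Bad m = ⊢ C ⇒ sub θ (seqt m)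

    bad? : ∀ m → Dec (Bad m)
    bad? m = provable? (C ⇒ sub θ (seqt m))

    -- E holds at a world exactly when every type realised above it is also the type,
    -- under θ, of some world of a model of C.
    E : Fm
    E = ⋀ (map seqt (filter bad? (signings S)))

    C-everywhere : ∀ τ {t} → t ⊩ C ↔ t ⊩ sub τ C
    C-everywhere τ {t} = subst (λ D → t ⊩ D ↔ t ⊩ sub τ C) (sub-par τ par-C) (id , id)

    realises-good : ∀ {τ t m} → t ⊩ sub τ E → m ∈ signings S → Signs (λ D → t ⊩ sub τ D) m → ¬ Bad m
    realises-good {τ} e i s b = signs⇒refutes s (⋀-elim τ e (∈-map⁺ seqt (∈-filter⁺ bad? i b)))

    good-realises : ∀ {τ t} →
      (∀ {s m} → t ≼ s → m ∈ signings S → Signs (λ D → s ⊩ sub τ D) m → ¬ Bad m) → t ⊩ sub τ E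
    good-realises {τ} {t} h = ⋀-intro τ conjunct
      where
      conjunct : ∀ {D} → D ∈ map seqt (filter bad? (signings S)) → t ⊩ sub τ D
      conjunct i with ∈-map∘filter⁻ seqt bad? {xs = signings S} i
      ... | m , m∈ , refl , b = λ t≼s p →
        decidable-stable (_ ⊩? sub τ (⋁ (signed false m))) λ n → h t≼s m∈ (refutes⇒signs p n) b

    good-model : ∀ {m} → ¬ Bad m → Σ Tree λ t → Signs (λ D → t ⊩ sub θ D) m
    good-model {m} ¬b with prove (C ⇒ sub θ (seqt m))
    ... | inj₁ b = contradiction b ¬b
    ... | inj₂ (t , ¬f)
      with somewhere? (λ s → (s ⊩? sub θ (⋀ (signed true m))) ×-dec ¬? (s ⊩? sub θ (⋁ (signed false m)))) t
    ...   | yes (s , _ , p , n) = s , refutes⇒signs p n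
    ...   | no ¬s = ⊥-elim (¬f λ t≼s _ {u} s≼u p → decidable-stable (u ⊩? sub θ (⋁ (signed false m)))
                                                     λ n → ¬s (u , ≼-trans t≼s s≼u , p , n))

    C⊢θE : ⊢ C ⇒ sub θ E
    C⊢θE = ⊩⇒⊢ λ c → ⋀-intro θ (conjunct c)
      where
      conjunct : ∀ {s D} → s ⊩ C → D ∈ map seqt (filter bad? (signings S)) → s ⊩ sub θ D
      conjunct c i with ∈-map∘filter⁻ seqt bad? {xs = signings S} i
      ... | m , m∈ , refl , b = sound b (λ ()) root c

    -- Since `C` proves `sub θ A` and `θ` fixes `C`, every type with `A ∧′ C` negative is bad, and
    -- worlds satisfying `E` have no bad type.
    E⊩A∧C : ∀ {t} → t ⊩ sub idS E → t ⊩ sub idS (A ∧′ C)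
    E⊩A∧C {t} e with signings-exist (λ D → t ⊩? sub idS D) S
    ... | m , m∈ , s with sign-of {S = S} (signings-support {S} m∈) (here refl)
    ...   | true  , i = s i
    ...   | false , i = contradiction bad (realises-good {idS} e m∈ s)
      where
      bad : Bad m
      bad = ⊩⇒⊢ λ c {_} p _ → ⋁-⊩⁺ θ (signed⁺ i)
        (mono (sub θ A) p (sound C⊢θA (λ ()) root c) , mono (sub θ C) p (proj₁ (C-everywhere θ) c))

    -- The Löwenheim substitution of the valuation `a`, composed with `τ`. Where `sub τ E` fails, a
    -- variable that is false in `a` fails, and one that is true in `a` holds once `τ x` holds at
    -- all worlds above that satisfy `sub τ E`.
    step : Vec Bool nv → Subst → Subst
    step a τ x = if lookup a x then sub τ E ⇒ τ x else sub τ E ∧′ τ x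

    run : List (Vec Bool nv) → Subst → Subst
    run []       τ = τ
    run (a ∷ as) τ = run as (step a τ)

    rounds : ℕ → Subst
    rounds zero    = idS
    rounds (suc n) = run (valuations nv) (rounds n)

    infix 3 _⊴_
    -- Worlds satisfying `sub τ E` are left as they are, so what is repaired stays repaired.
    _⊴_ : Subst → Subst → Set
    τ ⊴ τ′ = ∀ {t} → t ⊩ sub τ E → ∀ D → t ⊩ sub τ D ↔ t ⊩ sub τ′ D

    ⊴-E : ∀ {τ τ′ t} → τ ⊴ τ′ → t ⊩ sub τ E → t ⊩ sub τ′ E
    ⊴-E p e = proj₁ (p e E) e

    ⊴-refl : ∀ {τ} → τ ⊴ τ
    ⊴-refl _ _ = id , id

    ⊴-trans : ∀ {τ τ′ τ″} → τ ⊴ τ′ → τ′ ⊴ τ″ → τ ⊴ τ″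
    ⊴-trans {τ′ = τ′} p q e D =
      let (f , f′) = p e D ; (g , g′) = q (⊴-E {τ′ = τ′} p e) D in g ∘ f , f′ ∘ g′

    step-⊴ : ∀ a τ → τ ⊴ step a τ
    step-⊴ a τ {t} e = sub-agree variable-agree
      where
      variable-agree : ∀ {s} → t ≼ s → ∀ x → s ⊩ τ x ↔ s ⊩ step a τ x
      variable-agree p x with lookup a x
      ... | true  = (λ f q _ → mono (τ x) q f) , λ f → f root (mono (sub τ E) p e)
      ... | false = (λ f → mono (sub τ E) p e , f) , proj₂

    run-⊴ : ∀ as τ → τ ⊴ run as τ
    run-⊴ []       τ = ⊴-refl {τ}
    run-⊴ (a ∷ as) τ = ⊴-trans {τ} {step a τ} {run as (step a τ)} (step-⊴ a τ) (run-⊴ as (step a τ))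

    -- The valuation that repairs a world depends on the world, so a round tries all of them; `τ*`
    -- is the substitution reached when the turn of `a` comes.
    run-visits : ∀ {as a} → a ∈ as → ∀ τ → Σ Subst λ τ* → (τ ⊴ τ*) × (step a τ* ⊴ run as τ)
    run-visits {a ∷ as} (here refl) τ = τ , ⊴-refl {τ} , run-⊴ as (step a τ)
    run-visits {b ∷ as} (there i)   τ =
      let (τ* , p , q) = run-visits i (step b τ) in τ* , ⊴-trans {τ} {step b τ} {τ*} (step-⊴ b τ) p , q

    rounds-⊴ : ∀ n → idS ⊴ rounds n
    rounds-⊴ zero    = ⊴-refl {idS}
    rounds-⊴ (suc n) = ⊴-trans {idS} {rounds n} {rounds (suc n)} (rounds-⊴ n) (run-⊴ (valuations nv) (rounds n))

    -- Measure of progress at `k`: the types of repaired worlds above it, and the parameters failing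
    -- at it. Moving up the tree never adds marks, and passing along `⊴` never removes any.
    Mark : Subst → Tree → Type ⊎ Fin np → Set
    Mark τ k (inj₁ m) = Σ Tree λ u → k ≼ u × (u ⊩ sub τ E) × Signs (λ D → u ⊩ sub τ D) m
    Mark τ k (inj₂ j) = ¬ (k ⊩ at (par j))

    mark? : ∀ τ k x → Dec (Mark τ k x)
    mark? τ k (inj₁ m) = somewhere? (λ u → (u ⊩? sub τ E) ×-dec Signs? (λ D → u ⊩? sub τ D) m) k
    mark? τ k (inj₂ j) = ¬? (k ⊩? at (par j))

    markers : List (Type ⊎ Fin np)
    markers = map inj₁ (signings S) ++ map inj₂ (allFin np)

    marks : Subst → Tree → ℕ
    marks τ k = length (filter (mark? τ k) markers)

    Mark-≼ : ∀ {τ k s} → k ≼ s → ∀ {x} → Mark τ s x → Mark τ k x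
    Mark-≼ p {inj₁ m} (u , q , e , σ) = u , ≼-trans p q , e , σ
    Mark-≼ p {inj₂ j} n f             = n (mono (at (par j)) p f)

    Mark-⊴ : ∀ {τ τ′ k} → τ ⊴ τ′ → ∀ {x} → Mark τ k x → Mark τ′ k x
    Mark-⊴ {τ} {τ′} p {inj₁ m} (u , q , e , σ) = u , q , ⊴-E {τ} {τ′} p e , transfer
      where
      transfer : Signs (λ D → u ⊩ sub τ′ D) m
      transfer {D} {true}  i = proj₁ (p e D) (σ i)
      transfer {D} {false} i = σ i ∘ proj₂ (p e D)
    Mark-⊴ p {inj₂ j} n = n

    -- Gluing models under a new root

    infix 3 _∼[_]_
    _∼[_]_ : Tree → Subst → Tree → Set
    u ∼[ τ ] N = ∀ {D} → D ∈ S → u ⊩ sub τ D ↔ N ⊩ sub θ D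

    parsOf : Tree → Atom → Bool
    -- An arbitrary default: the value of `θ x` at the new root is merely read off, by `solution`.
    parsOf k (var _) = false
    parsOf k (par j) = does (k ⊩? at (par j))

    glue : Tree → List Tree → Tree
    glue k = node (parsOf k)

    solution : Tree → Vec Bool nv
    solution M = tabulate λ x → does (M ⊩? θ x)

    -- Repaired worlds above `k` are matched with the roots in `Ms`. `from-model` asks for a match
    -- above every failing world, so that all failing worlds resemble the single root of `M`.
    module Glue (τ : Subst) (k : Tree) (Ms : List Tree)
      (to-model   : ∀ {u} → k ≼ u → u ⊩ sub τ E → Σ Tree λ N → N ∈ Ms × (u ∼[ τ ] N))
      (from-model : ∀ {s N} → k ≼ s → ¬ (s ⊩ sub τ E) → N ∈ Ms →
                    Σ Tree λ u → s ≼ u × (u ⊩ sub τ E) × (u ∼[ τ ] N))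
      (same-pars  : ∀ {s j} → k ≼ s → ¬ (s ⊩ sub τ E) → s ⊩ at (par j) → k ⊩ at (par j))
      where

      M : Tree
      M = glue k Ms

      τ′ : Subst
      τ′ = step (solution M) τ

      -- Induction on `D`, for all failing worlds `s` at once. In the case of an implication, a
      -- world above `s` either fails too and is compared with the root of `M`, or is repaired and
      -- has a counterpart in `Ms`; conversely, each tree in `Ms` is matched above `s`.
      like-root : ∀ D → D ∈ S → ∀ {s} → k ≼ s → ¬ (s ⊩ sub τ E) → s ⊩ sub τ′ D ↔ M ⊩ sub θ D
      like-root (at (var x)) i {s} k≼s ¬e
        with M ⊩? θ x | lookup (solution M) x | lookup∘tabulate (λ y → does (M ⊩? θ y)) x
      -- A false value puts the failing `sub τ E` into a conjunction. A true value gives an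
      -- implication tested only at repaired worlds, whose counterparts inherit `θ x` from the root
      -- of `M`.
      ... | no ¬f | _ | refl = (λ (e , _) → contradiction e ¬e) , λ f → contradiction f ¬f
      ... | yes f | _ | refl = (λ _ → f) , λ _ {u} s≼u e →
        let (N , N∈ , u∼N) = to-model (≼-trans k≼s s≼u) e
        in proj₂ (u∼N i) (mono (θ x) (child N∈ root) f)
      like-root (at (par j)) i {s} k≼s ¬e = to , from
        where
        to : s ⊩ at (par j) → M ⊩ at (par j)
        to f root = dec-true (k ⊩? at (par j)) (same-pars k≼s ¬e f)
        to f (child N∈ p) =
          let (u , s≼u , _ , u∼N) = from-model k≼s ¬e N∈
          in proj₁ (u∼N i) (mono (at (par j)) s≼u f) p
        from : M ⊩ at (par j) → s ⊩ at (par j)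
        from f = mono (at (par j)) k≼s (decidable-stable (k ⊩? at (par j)) λ n →
          contradiction (trans (sym (f root)) (dec-false (k ⊩? at (par j)) n)) λ ())
      like-root ⊥′ i k≼s ¬e = id , id
      like-root (A ∧′ B) i k≼s ¬e with subs-Closed (_ ∧′ _) i
      ... | A∈ , B∈ with like-root A A∈ k≼s ¬e | like-root B B∈ k≼s ¬e
      ...   | f , f′ | g , g′ = (λ (a , b) → f a , g b) , λ (a , b) → f′ a , g′ b
      like-root (A ∨′ B) i k≼s ¬e with subs-Closed (_ ∧′ _) i
      ... | A∈ , B∈ with like-root A A∈ k≼s ¬e | like-root B B∈ k≼s ¬e
      ...   | f , f′ | g , g′ = Sum.map f g , Sum.map f′ g′
      like-root (A ⇒ B) i {s} k≼s ¬e with subs-Closed (_ ∧′ _) i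
      ... | A∈ , B∈ = to , from
        where
        to : s ⊩ sub τ′ (A ⇒ B) → M ⊩ sub θ (A ⇒ B)
        to f root a = proj₁ (like-root B B∈ k≼s ¬e) (f root (proj₂ (like-root A A∈ k≼s ¬e) a))
        to f (child N∈ p) a =
          let (u , s≼u , e , u∼N) = from-model k≼s ¬e N∈
          in proj₁ (u∼N i) (proj₂ (step-⊴ (solution M) τ e (A ⇒ B)) (mono (sub τ′ (A ⇒ B)) s≼u f)) p a
        from : M ⊩ sub θ (A ⇒ B) → s ⊩ sub τ′ (A ⇒ B)
        from f {u} s≼u a with u ⊩? sub τ E
        ... | yes e =
          let (N , N∈ , u∼N) = to-model (≼-trans k≼s s≼u) e
          in proj₁ (step-⊴ (solution M) τ e (A ⇒ B))
               (proj₂ (u∼N i) (mono (sub θ (A ⇒ B)) (child N∈ root) f)) root a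
        ... | no ¬e′ = proj₂ (like-root B B∈ (≼-trans k≼s s≼u) ¬e′)
                         (f root (proj₁ (like-root A A∈ (≼-trans k≼s s≼u) ¬e′) a))

      -- Worlds repaired before have good types already. The type of a failing world is now that of
      -- `M` under `θ`, and `M` satisfies `C` because `C` lies in `S` and is fixed by substitutions;
      -- so this type is good.
      repaired : k ⊩ C → k ⊩ sub τ′ E
      repaired c = good-realises good
        where
        good : ∀ {s m} → k ≼ s → m ∈ signings S → Signs (λ D → s ⊩ sub τ′ D) m → ¬ Bad m
        good {s} {m} k≼s m∈ σ b with s ⊩? sub τ E
        ... | yes e = realises-good {τ′} (⊴-E {τ} {τ′} (step-⊴ (solution M) τ) e) m∈ σ b
        ... | no ¬e = signs⇒refutes {θ} M-signs (sound b (λ ()) root M⊩C)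
          where
          C∈ : C ∈ S
          C∈ = proj₂ (subs-Closed (A ∧′ C) (here refl))
          M⊩C : M ⊩ C
          M⊩C = proj₂ (C-everywhere θ)
                  (proj₁ (like-root C C∈ k≼s ¬e) (proj₁ (C-everywhere τ′) (mono C k≼s c)))
          M-signs : Signs (λ D → M ⊩ sub θ D) m
          M-signs {D} {true}  i = proj₁ (like-root D (entry∈ (signings-support {S} m∈) i) k≼s ¬e) (σ i)
          M-signs {D} {false} i = σ i ∘ proj₂ (like-root D (entry∈ (signings-support {S} m∈) i) k≼s ¬e)

    -- If a round fails to repair k and adds no mark, all failing worlds above k see the same types
    -- and parameters as k throughout the round, so the valuation read off the glued model repairs k.
    round-progress : ∀ n → (∀ {s} → s ⊩ C → ¬ (s ⊩ sub (rounds n) E) → n ≤ marks (rounds n) s) →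
                     ∀ {k} → k ⊩ C → ¬ (k ⊩ sub (rounds (suc n)) E) → suc n ≤ marks (rounds (suc n)) k
    round-progress n ih {k} c ¬e = ≮⇒≥ λ lt → ¬e (Stuck.contradictory (s≤s⁻¹ lt))
      where
      τ τ₁ : Subst
      τ  = rounds n
      τ₁ = rounds (suc n)

      module Stuck (few : marks τ₁ k ≤ n) where

        type-model : ∀ m → m ∈ signings S →
          ¬ Mark τ k (inj₁ m) ⊎ Σ Tree λ N → Signs (λ D → N ⊩ sub θ D) m × Mark τ k (inj₁ m)
        type-model m m∈ with mark? τ k (inj₁ m)
        ... | no ¬p = inj₁ ¬p
        ... | yes p@(u , _ , e , σ) =
          let (N , σ′) = good-model (realises-good {τ} e m∈ σ) in inj₂ (N , σ′ , p)

        -- The valuation, and with it `τ*`, depends on the models. They are therefore chosen for the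
        -- types marked at the start of the round.
        models = collect (signings S) type-model

        Ms : List Tree
        Ms = proj₁ models

        visit : Σ Subst λ τ* → (τ ⊴ τ*) × (step (solution (glue k Ms)) τ* ⊴ τ₁)
        visit = run-visits (∈-valuations (solution (glue k Ms))) τ

        τ* : Subst
        τ* = proj₁ visit

        before : τ ⊴ τ*
        before = proj₁ (proj₂ visit)

        after : step (solution (glue k Ms)) τ* ⊴ τ₁
        after = proj₂ (proj₂ visit)

        after* : τ* ⊴ τ₁
        after* = ⊴-trans {τ*} {step (solution (glue k Ms)) τ*} {τ₁} (step-⊴ (solution (glue k Ms)) τ*) after

        -- By the induction hypothesis `k` has at least `n` marks under `τ`, and it has at most `n`
        -- under `τ₁`; as `τ*` lies between, its marks are the same.
        constant : ∀ {x} → x ∈ markers → Mark τ* k x → Mark τ k x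
        constant i p = filter-tight (mark? τ k) (mark? τ₁ k)
          (λ {x} → Mark-⊴ (⊴-trans {τ} {τ*} {τ₁} before after*) {x}) markers
          (≤-trans few (ih c λ e → ¬e (⊴-E {τ} {τ₁} (run-⊴ (valuations nv) τ) e)))
          i (Mark-⊴ after* p)

        -- A world failing under `τ*` failed under `τ`, so it has at least `n` marks, while `k`
        -- below it has at most `n`.
        uniform : ∀ {s} → k ≼ s → ¬ (s ⊩ sub τ* E) → ∀ {x} → x ∈ markers → Mark τ* k x → Mark τ* s x
        uniform {s} k≼s ¬e* = filter-tight (mark? τ* s) (mark? τ* k) (λ {x} → Mark-≼ k≼s {x}) markers
          (≤-trans (filter-mono (mark? τ* k) (mark? τ₁ k) (λ {x} → Mark-⊴ after* {x}) markers)
          (≤-trans few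
          (≤-trans (ih (mono C k≼s c) λ e → ¬e* (⊴-E {τ} {τ*} before e))
                   (filter-mono (mark? τ s) (mark? τ* s) (λ {x} → Mark-⊴ before {x}) markers))))

        type∈ : ∀ {m} → m ∈ signings S → inj₁ m ∈ markers
        type∈ m∈ = ∈-++⁺ˡ (∈-map⁺ inj₁ m∈)

        to-model : ∀ {u} → k ≼ u → u ⊩ sub τ* E → Σ Tree λ N → N ∈ Ms × (u ∼[ τ* ] N)
        to-model {u} k≼u e with signings-exist (λ D → u ⊩? sub τ* D) S
        ... | m , m∈ , σ with proj₁ (proj₂ models) m m∈
        ...   | inj₁ ¬p = contradiction (constant (type∈ m∈) (u , k≼u , e , σ)) ¬p
        ...   | inj₂ (N , N∈ , σ′ , _) = N , N∈ , agree (signings-support {S} m∈) σ σ′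

        from-model : ∀ {s N} → k ≼ s → ¬ (s ⊩ sub τ* E) → N ∈ Ms →
                     Σ Tree λ u → s ≼ u × (u ⊩ sub τ* E) × (u ∼[ τ* ] N)
        from-model k≼s ¬e* N∈ with proj₂ (proj₂ models) _ N∈
        ... | m , m∈ , σ′ , p with uniform k≼s ¬e* (type∈ m∈) (Mark-⊴ before {inj₁ m} p)
        ...   | u , s≼u , e , σ = u , s≼u , e , agree (signings-support {S} m∈) σ σ′

        same-pars : ∀ {s j} → k ≼ s → ¬ (s ⊩ sub τ* E) → s ⊩ at (par j) → k ⊩ at (par j)
        same-pars {j = j} k≼s ¬e* f = decidable-stable (k ⊩? at (par j)) λ n →
          uniform k≼s ¬e* {inj₂ j} (∈-++⁺ʳ (map inj₁ (signings S)) (∈-map⁺ inj₂ (∈-allFin j))) n f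

        contradictory : k ⊩ sub τ₁ E
        contradictory = ⊴-E {step (solution (glue k Ms)) τ*} {τ₁} after
          (Glue.repaired τ* k Ms to-model from-model same-pars c)

    failing-marks : ∀ n {k} → k ⊩ C → ¬ (k ⊩ sub (rounds n) E) → n ≤ marks (rounds n) k
    failing-marks zero    c ¬e = z≤n
    failing-marks (suc n) c ¬e = round-progress n (failing-marks n) c ¬e

    -- One round more than there are markers: a world of `C` still failing would carry more marks
    -- than exist.
    σ : Subst
    σ = rounds (suc (length markers))

    C⊩σE : ∀ {k} → k ⊩ C → k ⊩ sub σ E
    C⊩σE {k} c = decidable-stable (k ⊩? sub σ E) λ ¬e →
      <⇒≱ (failing-marks (suc (length markers)) c ¬e) (length-filter (mark? σ k) markers)

    -- The rounds start at the identity, and no step changes anything where `E` holds.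
    E-fixed : ∀ {t} → t ⊩ E → ∀ D → t ⊩ D ↔ t ⊩ sub σ D
    E-fixed {t} e D = subst (λ X → t ⊩ X ↔ t ⊩ sub σ D) (sub-id D)
      (rounds-⊴ (suc (length markers)) (subst (t ⊩_) (sym (sub-id E)) e) D)

    E-projective : Projective E σ
    E-projective a = ⊢-deduce (⊩⇒⊢ λ e →
      (λ {_} p → proj₁ (E-fixed (mono E p e) (at a))) , λ {_} p → proj₂ (E-fixed (mono E p e) (at a)))

    E⊢A∧C : ⊢ E ⇒ A ∧′ C
    E⊢A∧C = ⊩⇒⊢ λ {t} e → subst (t ⊩_) (sub-id (A ∧′ C)) (E⊩A∧C (subst (t ⊩_) (sym (sub-id E)) e))

    -- From left to right, `σ` is applied to the derivation of `C` from `E`; this is why `S` is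
    -- built from `A ∧′ C` and not from `A` alone.
    σE⇔C : ⊢ sub σ E ⇔ C
    σE⇔C = ∧I (⊩⇒⊢ λ e → proj₂ (C-everywhere σ) (proj₂ (sound (sub-⊢ σ E⊢A∧C) (λ ()) root e)))
              (⊩⇒⊢ C⊩σE)

  -- The two implications between preservativity and admissibility

  Adm⇒Pres : ∀ {A B} → Adm NNILpar A B → Pres DownNNILpar A B
  Adm⇒Pres {A} {B} adm E (θ , proj , E′ , nnil , eq) E⊢A =
    ⊩⇒⊢ λ {t} e → proj₂ (fixed e B) (sound θE⊢θB (λ ()) root (proj₁ (fixed e E) e))
    where
    fixed : ∀ {t} → t ⊩ E → ∀ D → t ⊩ D ↔ t ⊩ sub θ D
    fixed {t} e D = subst (λ X → t ⊩ X ↔ t ⊩ sub θ D) (sub-id D) (sub-agree agree-at D)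
      where
      agree-at : ∀ {s} → t ≼ s → ∀ x → s ⊩ idS x ↔ s ⊩ θ x
      agree-at p x = let (f , g) = sound (proj (var x)) λ { (here refl) → mono E p e } in f root , g root
    θE′ : sub θ E′ ≡ E′
    θE′ = sub-par θ (proj₂ nnil)
    θE⊢θB : ⊢ sub θ (E ⇒ B)
    θE⊢θB = chain (∧E₁ eq) (subst (λ X → ⊢ X ⇒ sub θ B) θE′ (adm θ E′ nnil
             (subst (λ X → ⊢ X ⇒ sub θ A) (sym θE′) (chain (∧E₂ eq) (sub-⊢ θ E⊢A)))))

  Pres⇒Adm : ∀ {A B} → Pres DownNNILpar A B → Adm NNILpar A B
  Pres⇒Adm {A} {B} pres θ C nnil@(_ , par-C) C⊢θA =
    subst (λ X → ⊢ X ⇒ sub θ B) (sym θC)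
      (chain C⊢θE (sub-⊢ θ (pres E (σ , E-projective , C , nnil , σE⇔C) (⇒I (∧E₁ (⊢-deduce E⊢A∧C))))))
    where
    θC : sub θ C ≡ C
    θC = sub-par θ par-C
    open Approximation A C θ par-C (subst (λ X → ⊢ X ⇒ sub θ A) θC C⊢θA)

theorem4p17 : (nv np : ℕ) → let open IPC nv np in
    ∀ (A B : Fm) → (Pres DownNNILpar A B → Adm NNILpar A B) × (Adm NNILpar A B → Pres DownNNILpar A B)
theorem4p17 nv np A B = Pres⇒Adm nv np , Adm⇒Pres nv np
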